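{- For all positive integers $d$ and $q$, there exists a connected graph $G$ with $\mathrm{diam}(G)=d$ and \[ \Delta(G)=\begin{cases} 2^{q}-1, & \text{if } d=1,\\ 2^{q}, & \text{if } d=2,\\ 2^{q}+1, & \text{if } d\geq 3,\end{cases} \] such that $G$ admits an interval edge coloring (i.e. $G\in\mathfrak{N}$) and \[ W(G)\geq \begin{cases} (d+1)(\Delta(G)-1)-q+2, & \text{if } d=1,\\ (d+1)(\Delta(G)-1)-q+1, & \text{if } d=2,\\ (d+1)(\Delta(G)-1)-q-2, & \text{if } d\geq 3.\end{cases} \]
   Context: All graphs are finite, undirected, without loops or multiple edges. $\Delta(G)$ denotes the maximum degree of $G$ and $\mathrm{diam}(G)$ its diameter. For a positive integer $t$, an interval $t$-coloring of a graph $G$ is a map assigning to each edge of $G$ a color from $\{1,2,\ldots,t\}$ such that every color $i\in\{1,\ldots,t\}$ is used on at least one edge, edges sharing a vertex receive distinct colors, and for each vertex $v$ the set of colors of edges incident to $v$ is an interval of consecutive integers. $\mathfrak{N}$ denotes the set of graphs that admit an interval $t$-coloring for some $t$, and for $G\in\mathfrak{N}$, $W(G)$ denotes the greatest $t$ for which $G$ has an interval $t$-coloring. -}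

module Defs where

open import Data.Bool.Base using (Bool; T)
open import Data.Fin.Base using (Fin)
open import Data.Fin.Subset using (Subset; ∣_∣)
open import Data.List.Base using (map; allFin)
open import Data.List.Extrema.Nat using (max)
open import Data.Nat.Base using (ℕ; suc; _≤_)
open import Data.Product.Base using (_×_; ∃-syntax)
open import Data.Vec.Base using (tabulate)
open import Relation.Binary.Construct.Closure.ReflexiveTransitive using (Star; ε; _◅_)
open import Relation.Binary.PropositionalEquality.Core using (_≡_; _≢_)
open import Relation.Nullary.Negation.Core using (¬_)

-- Adjacency is Boolean, so that the type u ~ v has at most one element:
-- there are no multiple edges.
record Graph : Set where
  field
    order    : ℕ
    adj      : Fin order → Fin order → Bool
    ~-sym    : ∀ {u v} → T (adj u v) → T (adj v u)
    ~-irrefl : ∀ {v} → ¬ T (adj v v)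

  Vertex : Set
  Vertex = Fin order

  infix 4 _~_
  _~_ : Vertex → Vertex → Set
  u ~ v = T (adj u v)

  neighbours : Vertex → Subset order
  neighbours v = tabulate (adj v)

  degree : Vertex → ℕ
  degree v = ∣ neighbours v ∣

  Walk : Vertex → Vertex → Set
  Walk = Star _~_

  length : ∀ {u v} → Walk u v → ℕ
  length ε       = 0
  length (_ ◅ p) = suc (length p)

open Graph public using (Vertex; degree)

Δ : Graph → ℕ
Δ G = max 0 (map (degree G) (allFin (Graph.order G)))

Connected : Graph → Set
Connected G = ∀ u v → Graph.Walk G u v

-- A shortest walk repeats no vertex, so minimising over walks or over paths
-- gives the same distance.
IsDistance : (G : Graph) → Vertex G → Vertex G → ℕ → Set
IsDistance G u v k =
  (∃[ p ] length {u} {v} p ≡ k) × (∀ (p : Walk u v) → k ≤ length p)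
  where open Graph G using (Walk; length)

IsDiameter : Graph → ℕ → Set
IsDiameter G d =
  (∀ u v → ∃[ k ] IsDistance G u v k × k ≤ d) ×
  (∃[ u ] ∃[ v ] IsDistance G u v d)

record IntervalColoring (G : Graph) (t : ℕ) : Set where
  open Graph G using (_~_)
  field
    -- An undirected edge is seen from both of its ends; color-sym makes this
    -- a function of the edge.
    color     : (u v : Vertex G) → u ~ v → ℕ
    color-sym : ∀ {u v} (e : u ~ v) (e′ : v ~ u) → color u v e ≡ color v u e′

  ColorAt : Vertex G → ℕ → Set
  ColorAt v i = ∃[ w ] ∃[ e ] color v w e ≡ i

  field
    t-positive  : 1 ≤ t
    color-range : ∀ {u v} (e : u ~ v) → 1 ≤ color u v e × color u v e ≤ t
    all-used    : ∀ i → 1 ≤ i → i ≤ t → ∃[ v ] ColorAt v i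
    proper      : ∀ {v u w} (e : v ~ u) (e′ : v ~ w) → u ≢ w →
                  color v u e ≢ color v w e′
    interval    : ∀ v {i j k} → ColorAt v i → ColorAt v k →
                  i ≤ j → j ≤ k → ColorAt v j

𝔑 : Graph → Set
𝔑 G = ∃[ t ] IntervalColoring G t

-- IsW G w says that W(G) = w.
IsW : Graph → ℕ → Set
IsW G w = IntervalColoring G w × (∀ t → IntervalColoring G t → t ≤ w)

-- A three-way case distinction "d = 1, d = 2, d ≥ 3". It is meant for positive d
-- only; the value at 0 is junk.
byDiameter : {A : Set} → ℕ → A → A → A → A
byDiameter 1 x _ _ = x
byDiameter 2 _ y _ = y
byDiameter _ _ _ z = z

{-# OPTIONS --safe #-}
-- The graph is the Cartesian product of the complete graph K on N = 2^q
-- vertices with the path on d vertices; its distance is the path distance plus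
-- the discrete distance on K. Add to K a loop at each vertex x, coloured
-- start x, so that the colours at x fill [start x , start x + N − 1] and the
-- loop has the least one. Giving the edge (i , x) – (j , y) the colour of xy
-- plus max (i , j) · N, the edges from layer i to layer i + 1 get the colour
-- that the loop at x would have in layer i + 1, hence the intervals of
-- consecutive layers fit together. The colouring of K is obtained by doubling:
-- in two copies of K, shift the colours of the cross edges by N and those of
-- the second copy by 2N − 1. The largest colour obtained is
-- (d + 1) N − q − 2. That W exists as a maximum is decided by a finite search.
module Submission where

open import Defs
open import Data.Bool.Properties using (T?; T-≡; T-irrelevant)
open import Data.Fin.Base using (Fin; zero; suc; toℕ; fromℕ; fromℕ<; inject₁; splitAt; join; combine; remQuot; finToFun; funToFin)
open import Data.Fin.Properties using (any?; all?; toℕ-fromℕ<; toℕ-fromℕ; toℕ-inject₁; toℕ-injective; toℕ<n; toℕ≤pred[n]; injective⇒≤; combine-injective; remQuot-combine; combine-remQuot; finToFun-funToFin; splitAt-join; join-splitAt) renaming (_≟_ to _≟ᶠ_)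
open import Data.Fin.Subset using (Subset; ∣_∣; _∈_; outside; inside) renaming (_-_ to infixl 5 _∖_)
open import Data.Fin.Subset.Properties using (Empty-unique; ∣⊥∣≡0; p─⊥≡p; p─q⊆p; x∈p∧x≢y⇒x∈p-y)
import Data.Integer.Base as ℤ
import Data.Integer.Properties as ℤ
open import Data.Integer.Solver using (module +-*-Solver)
open import Data.List.Base using (map; allFin)
open import Data.List.Extrema.Nat using (max≤v⁺; xs≤max)
open import Data.List.Membership.Propositional.Properties using (∈-map⁺; ∈-allFin)
import Data.List.Relation.Unary.All as All
import Data.List.Relation.Unary.All.Properties as All
open import Data.Nat.Base using (ℕ; zero; suc; _≤_; _<_; _+_; _*_; _∸_; _^_; _⊔_; _⊓_; ∣_-_∣; z≤n; s≤s; s≤s⁻¹)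
open import Data.Nat.Properties
open import Data.Nat.Tactic.RingSolver using (solve-∀)
open import Data.Product.Base using (_×_; _,_; ∃-syntax; proj₁; proj₂; uncurry)
open import Data.Sum.Base using (_⊎_; inj₁; inj₂)
open import Data.Vec.Base using (_∷_; here; there; tabulate)
open import Data.Vec.Properties using (lookup∘tabulate; lookup⇒[]=; []=⇒lookup)
open import Function.Base using (_∘_)
open import Function.Bundles using (Equivalence)
open import Relation.Binary.Construct.Closure.ReflexiveTransitive using (ε; _◅_)
open import Relation.Binary.PropositionalEquality
open import Relation.Nullary.Decidable using (¬?)
open import Relation.Nullary.Decidable.Core using (Dec; yes; no; ⌊_⌋; map′; toWitness; fromWitness; _×-dec_; _→-dec_)
open import Relation.Nullary.Negation.Core using (¬_; contradiction)

-- Existence of W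

-- The bound is lowered by one each time it fails `P`. At bound 0 the given `t` must itself be 0, so
-- the search always ends with a witness.
greatest : {P : ℕ → Set} → (∀ t → Dec (P t)) → ∀ {t} → P t → ∀ b → (∀ {s} → P s → s ≤ b) →
           ∃[ w ] P w × (∀ s → P s → s ≤ w)
greatest P? Pt zero bound with n≤0⇒n≡0 (bound Pt)
... | refl = 0 , Pt , λ _ → bound
greatest P? Pt (suc b) bound with P? (suc b)
... | yes Pb = suc b , Pb , λ _ → bound
... | no ¬Pb = greatest P? Pt b λ Ps →
  s≤s⁻¹ (≤∧≢⇒< (bound Ps) λ { refl → ¬Pb Ps })

module _ (G : Graph) where
  open Graph G using (_~_; adj; order)

  private
    color-cong : ∀ {t} (C : IntervalColoring G t) → let open IntervalColoring C in
                 ∀ {u v u′ v′} (e : u ~ v) (e′ : u′ ~ v′) → u ≡ u′ → v ≡ v′ →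
                 color u v e ≡ color u′ v′ e′
    color-cong C {u} {v} e e′ refl refl =
      cong (IntervalColoring.color C u v) (T-irrelevant e e′)

  -- Choosing for each colour an edge that carries it is injective, and an edge is an ordered pair
  -- of vertices.
  colors≤order² : ∀ {t} → IntervalColoring G t → t ≤ order * order
  colors≤order² {t} C = injective⇒≤ {f = witness} λ {i} {j} eq →
    let _ , _ , e  , ≡i = used i
        _ , _ , e′ , ≡j = used j
        u≡u′ , v≡v′ = combine-injective _ _ _ _ eq
    in toℕ-injective (suc-injective (trans (sym ≡i) (trans (color-cong C e e′ u≡u′ v≡v′) ≡j)))
    where
    open IntervalColoring C
    used : (i : Fin t) → ∃[ v ] ColorAt v (suc (toℕ i))
    used i = all-used (suc (toℕ i)) (s≤s z≤n) (toℕ<n i)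
    witness : Fin t → Fin (order * order)
    witness i = let v , w , _ = used i in combine v w

  module _ (t : ℕ) where

    -- Colourings are packed into the elements of one finite set, so that all of them can be tried.
    -- Pairs that are not adjacent have an entry too, which `Valid` never reads.
    Table : Set
    Table = Fin (suc t ^ (order * order))

    entry : Table → Vertex G → Vertex G → ℕ
    entry c u v = toℕ (finToFun c (combine u v))

    Occurs : Table → Vertex G → ℕ → Set
    Occurs c v i = ∃[ w ] v ~ w × entry c v w ≡ i

    -- The conditions on a colouring with every quantifier over a finite set. Colours at a vertex
    -- are given by the edges carrying them, and `j` can be bounded by `t` because entries are.
    Valid : Table → Set
    Valid c =
      1 ≤ t ×
      (∀ u v → u ~ v → entry c u v ≡ entry c v u × 1 ≤ entry c u v) ×
      (∀ (i : Fin t) → ∃[ v ] Occurs c v (suc (toℕ i))) ×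
      (∀ v u w → v ~ u → v ~ w → ¬ u ≡ w → ¬ entry c v u ≡ entry c v w) ×
      (∀ v u w → v ~ u → v ~ w → ∀ (j : Fin (suc t)) →
         entry c v u ≤ toℕ j → toℕ j ≤ entry c v w → Occurs c v (toℕ j))

    occurs? : ∀ c v i → Dec (Occurs c v i)
    occurs? c v i = any? λ w → T? (adj v w) ×-dec entry c v w ≟ i

    valid? : ∀ c → Dec (Valid c)
    valid? c =
      (1 ≤? t) ×-dec
      (all? λ u → all? λ v → T? (adj u v) →-dec
         (entry c u v ≟ entry c v u ×-dec 1 ≤? entry c u v)) ×-dec
      (all? λ i → any? λ v → occurs? c v (suc (toℕ i))) ×-dec
      (all? λ v → all? λ u → all? λ w → T? (adj v u) →-dec T? (adj v w) →-dec
         ¬? (u ≟ᶠ w) →-dec ¬? (entry c v u ≟ entry c v w)) ×-dec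
      (all? λ v → all? λ u → all? λ w → T? (adj v u) →-dec T? (adj v w) →-dec
         all? λ j → entry c v u ≤? toℕ j →-dec toℕ j ≤? entry c v w →-dec
           occurs? c v (toℕ j))

    coloring : ∃[ c ] Valid c → IntervalColoring G t
    coloring (c , 1≤t , edge , used , prop , inter) = record
      { color       = λ u v _ → entry c u v
      ; color-sym   = λ e _ → proj₁ (edge _ _ e)
      ; t-positive  = 1≤t
      ; color-range = λ {u} {v} e → proj₂ (edge _ _ e) , entry≤t u v
      ; all-used    = λ { (suc i) _ i<t → let v , w , e , eq = used (fromℕ< i<t)
                          in v , w , e , trans eq (cong suc (toℕ-fromℕ< i<t)) }
      ; proper      = λ e e′ → prop _ _ _ e e′
      ; interval    = λ { v {j = j} (u , e , refl) (w , e′ , refl) i≤j j≤k →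
          let j<1+t = s≤s (≤-trans j≤k (entry≤t v w))
              j≡ = toℕ-fromℕ< j<1+t
              x , f , eq = inter v u w e e′ (fromℕ< j<1+t)
                (subst (_ ≤_) (sym j≡) i≤j) (subst (_≤ _) (sym j≡) j≤k)
          in x , f , trans eq j≡ }
      }
      where
      entry≤t : ∀ u v → entry c u v ≤ t
      entry≤t u v = toℕ≤pred[n] (finToFun c (combine u v))

    table : IntervalColoring G t → ∃[ c ] Valid c
    table C = c , t-positive ,
      (λ u v e → trans (entry≡ e) (trans (color-sym e (Graph.~-sym G e)) (sym (entry≡ _)))
               , subst (1 ≤_) (sym (entry≡ e)) (proj₁ (color-range e))) ,
      (λ i → let v , w , e , eq = all-used _ (s≤s z≤n) (toℕ<n i)
             in v , w , e , trans (entry≡ e) eq) ,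
      (λ v u w e e′ u≢w eq →
         proper e e′ u≢w (trans (sym (entry≡ e)) (trans eq (entry≡ e′)))) ,
      (λ v u w e e′ j i≤j j≤k →
         let x , f , eq = interval v (u , e , sym (entry≡ e)) (w , e′ , sym (entry≡ e′)) i≤j j≤k
         in x , f , trans (entry≡ f) eq)
      where
      open IntervalColoring C
      bounded : ∀ u v → ∃[ i ] (∀ e → toℕ {suc t} i ≡ color u v e)
      bounded u v with T? (adj u v)
      -- Default entry for a pair that is not an edge.
      ... | no ¬e = zero , λ e → contradiction e ¬e
      ... | yes e = fromℕ< (s≤s (proj₂ (color-range e))) , λ e′ →
        trans (toℕ-fromℕ< _) (color-cong C e e′ refl refl)
      f : Fin (order * order) → Fin (suc t)
      f = uncurry (λ u v → proj₁ (bounded u v)) ∘ remQuot order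
      c : Table
      c = funToFin f
      entry≡ : ∀ {u v} e → entry c u v ≡ color u v e
      entry≡ {u} {v} e = trans
        (cong toℕ (trans (finToFun-funToFin f (combine u v))
                         (cong (uncurry λ u v → proj₁ (bounded u v)) (remQuot-combine u v))))
        (proj₂ (bounded u v) e)

    intervalColoring? : Dec (IntervalColoring G t)
    intervalColoring? = map′ coloring table (any? valid?)

  ∃W : ∀ {t} → IntervalColoring G t → ∃[ w ] IsW G w × t ≤ w
  ∃W C =
    let w , Cw , max = greatest intervalColoring? C (order * order) colors≤order²
    in w , (Cw , max) , max _ C

-- Interval colourings of complete graphs with loops

-- start x is the colour of the loop at x, and start x + offset x y that of xy.
record Staircase (V : Set) (m : ℕ) : Set where
  field
    start  : V → ℕ
    offset : V → V → ℕ
    symmetric         : ∀ x y → start x + offset x y ≡ start y + offset y x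
    offset-loop       : ∀ x → offset x x ≡ 0
    offset-≤          : ∀ x y → offset x y ≤ m
    offset-injective  : ∀ x {y z} → offset x y ≡ offset x z → y ≡ z
    offset-surjective : ∀ x {k} → k ≤ m → ∃[ y ] offset x y ≡ k
    bottom top        : V
    start-bottom      : start bottom ≡ 0
    start-≤           : ∀ x → start x ≤ start top

module _ {V : Set} {m : ℕ} (S : Staircase V m) where
  open Staircase S

  private
    -- Offsets within the second copy: those of proper edges make room for the
    -- m + 1 cross edges, which come right after the loop.
    jump : ℕ → ℕ
    jump zero    = 0
    jump (suc k) = suc m + suc k

    jump-≤ : ∀ {k} → k ≤ m → jump k ≤ m + suc m
    jump-≤ {zero}  _   = z≤n
    jump-≤ {suc k} k≤m = ≤-trans (+-monoʳ-≤ (suc m) k≤m) (≤-reflexive (+-comm (suc m) m))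

    jump-injective : ∀ {k l} → jump k ≡ jump l → k ≡ l
    jump-injective {zero}  {zero}  _  = refl
    jump-injective {suc k} {suc l} eq = +-cancelˡ-≡ (suc m) _ _ eq

    suc≢jump : ∀ {k} l → k ≤ m → suc k ≢ jump l
    suc≢jump (suc l) k≤m eq = <-irrefl eq (s≤s (≤-trans (s≤s k≤m) (m<m+n m (s≤s z≤n))))

    flat≢raised : ∀ {k} l → k ≤ m → k ≢ suc m + l
    flat≢raised l k≤m eq = <-irrefl eq (s≤s (≤-trans k≤m (m≤m+n m l)))

    -- A loop of the second copy is shifted by `m` only: the lowest cross edge at `inj₂ x` has
    -- colour `start x + suc m`, and the loop goes just below it.
    start′ : V ⊎ V → ℕ
    start′ (inj₁ x) = start x
    start′ (inj₂ x) = start x + m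

    -- In the first copy the old offsets keep 0 to m and the cross edges take m + 1 to 2m + 1. In
    -- the second copy the loop has 0, the cross edges 1 to m + 1, and the remaining edges m + 2 to
    -- 2m + 1.
    offset′ : V ⊎ V → V ⊎ V → ℕ
    offset′ (inj₁ x) (inj₁ y) = offset x y
    offset′ (inj₁ x) (inj₂ y) = suc m + offset x y
    offset′ (inj₂ x) (inj₁ y) = suc (offset x y)
    offset′ (inj₂ x) (inj₂ y) = jump (offset x y)

    cross : ∀ a b m → a + (suc m + b) ≡ a + b + suc m
    cross = solve-∀

    cross′ : ∀ a b m → a + m + suc b ≡ a + b + suc m
    cross′ = solve-∀

    raised : ∀ a b m → a + m + (suc m + suc b) ≡ a + suc b + (m + suc m)
    raised = solve-∀

    symmetric′ : ∀ u v → start′ u + offset′ u v ≡ start′ v + offset′ v u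
    symmetric′ (inj₁ x) (inj₁ y) = symmetric x y
    symmetric′ (inj₁ x) (inj₂ y) =
      trans (cross (start x) (offset x y) m)
      (trans (cong (_+ suc m) (symmetric x y)) (sym (cross′ (start y) (offset y x) m)))
    symmetric′ (inj₂ x) (inj₁ y) = sym (symmetric′ (inj₁ y) (inj₂ x))
    symmetric′ (inj₂ x) (inj₂ y) with offset x y in eq | offset y x in eq′ | symmetric x y
    -- `jump` treats 0 separately, but offset 0 occurs only at loops, so both offsets vanish or
    -- neither does.
    ... | zero  | _     | _ with offset-injective x (trans eq (sym (offset-loop x)))
    ...   | refl = cong (λ k → start x + m + jump k) (trans (sym (offset-loop x)) eq′)
    symmetric′ (inj₂ x) (inj₂ y) | suc k | zero | _
      with refl ← offset-injective y (trans eq′ (sym (offset-loop y)))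
      with () ← trans (sym eq) eq′
    symmetric′ (inj₂ x) (inj₂ y) | suc k | suc l | s =
      trans (raised (start x) k m)
      (trans (cong (_+ (m + suc m)) s) (sym (raised (start y) l m)))

    offset-injective′ : ∀ u {v w} → offset′ u v ≡ offset′ u w → v ≡ w
    offset-injective′ (inj₁ x) {inj₁ y} {inj₁ z} eq = cong inj₁ (offset-injective x eq)
    offset-injective′ (inj₁ x) {inj₁ y} {inj₂ z} eq =
      contradiction eq (flat≢raised _ (offset-≤ x y))
    offset-injective′ (inj₁ x) {inj₂ y} {inj₁ z} eq =
      contradiction (sym eq) (flat≢raised _ (offset-≤ x z))
    offset-injective′ (inj₁ x) {inj₂ y} {inj₂ z} eq =
      cong inj₂ (offset-injective x (+-cancelˡ-≡ (suc m) _ _ eq))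
    offset-injective′ (inj₂ x) {inj₁ y} {inj₁ z} eq =
      cong inj₁ (offset-injective x (suc-injective eq))
    offset-injective′ (inj₂ x) {inj₁ y} {inj₂ z} eq =
      contradiction eq (suc≢jump (offset x z) (offset-≤ x y))
    offset-injective′ (inj₂ x) {inj₂ y} {inj₁ z} eq =
      contradiction (sym eq) (suc≢jump (offset x y) (offset-≤ x z))
    offset-injective′ (inj₂ x) {inj₂ y} {inj₂ z} eq =
      cong inj₂ (offset-injective x (jump-injective eq))

    offset-≤′ : ∀ u v → offset′ u v ≤ m + suc m
    offset-≤′ (inj₁ x) (inj₁ y) = ≤-trans (offset-≤ x y) (m≤m+n m _)
    offset-≤′ (inj₁ x) (inj₂ y) =
      ≤-trans (+-monoʳ-≤ (suc m) (offset-≤ x y)) (≤-reflexive (+-comm (suc m) m))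
    offset-≤′ (inj₂ x) (inj₁ y) = ≤-trans (s≤s (offset-≤ x y)) (m≤n+m (suc m) m)
    offset-≤′ (inj₂ x) (inj₂ y) = jump-≤ (offset-≤ x y)

    offset-surjective′ : ∀ u {k} → k ≤ m + suc m → ∃[ v ] offset′ u v ≡ k
    offset-surjective′ (inj₁ x) {k} k≤ with k ≤? m
    ... | yes k≤m = let y , eq = offset-surjective x k≤m in inj₁ y , eq
    ... | no  k≰m with l , refl ← m≤n⇒∃[o]m+o≡n (≰⇒> k≰m) =
      let y , eq = offset-surjective x (+-cancelʳ-≤ (suc m) l m (subst (_≤ m + suc m) (+-comm (suc m) l) k≤))
      in inj₂ y , cong (suc m +_) eq
    offset-surjective′ (inj₂ x) {zero} _ = inj₂ x , cong jump (offset-loop x)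
    offset-surjective′ (inj₂ x) {suc k} k≤ with k ≤? m
    ... | yes k≤m = let y , eq = offset-surjective x k≤m in inj₁ y , cong suc eq
    -- The wanted offset is `suc (suc m + l)`, which `jump` takes at `suc l`.
    ... | no  k≰m with l , refl ← m≤n⇒∃[o]m+o≡n (≰⇒> k≰m) =
      let y , eq = offset-surjective x (+-cancelˡ-≤ (suc m) (suc l) m
                     (≤-trans (≤-reflexive (+-suc (suc m) l)) (≤-trans k≤ (≤-reflexive (+-comm m (suc m))))))
      in inj₂ y , trans (cong jump eq) (+-suc (suc m) l)

  double : Staircase (V ⊎ V) (m + suc m)
  double = record
    { start             = start′
    ; offset            = offset′
    ; symmetric         = symmetric′
    ; offset-loop       = λ { (inj₁ x) → offset-loop x ; (inj₂ x) → cong jump (offset-loop x) }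
    ; offset-≤          = offset-≤′
    ; offset-injective  = offset-injective′
    ; offset-surjective = offset-surjective′
    ; bottom            = inj₁ bottom
    ; top               = inj₂ top
    ; start-bottom      = start-bottom
    ; start-≤           = λ { (inj₁ x) → ≤-trans (start-≤ x) (m≤m+n _ m)
                            ; (inj₂ x) → +-monoˡ-≤ m (start-≤ x) }
    }

-- 2^q - 1, by the recursion that `double` performs on `m`; so the vertex set of the doubled
-- staircase has the right size by computation.
pred2^ : ℕ → ℕ
pred2^ zero    = 0
pred2^ (suc q) = pred2^ q + suc (pred2^ q)

suc-pred2^ : ∀ q → suc (pred2^ q) ≡ 2 ^ q
suc-pred2^ zero    = refl
suc-pred2^ (suc q) = trans (cong₂ _+_ (suc-pred2^ q) (suc-pred2^ q))
  (cong (2 ^ q +_) (sym (+-identityʳ (2 ^ q))))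

relabel : ∀ {A B : Set} {m} (f : B → A) (g : A → B) → (∀ a → f (g a) ≡ a) →
          (∀ b → g (f b) ≡ b) → Staircase A m → Staircase B m
relabel f g fg gf S = record
  { start             = λ b → start (f b)
  ; offset            = λ b c → offset (f b) (f c)
  ; symmetric         = λ b c → symmetric (f b) (f c)
  ; offset-loop       = λ b → offset-loop (f b)
  ; offset-≤          = λ b c → offset-≤ (f b) (f c)
  ; offset-injective  = λ b {c} {c′} eq →
      trans (sym (gf c)) (trans (cong g (offset-injective (f b) eq)) (gf c′))
  ; offset-surjective = λ b k≤m → let a , eq = offset-surjective (f b) k≤m
                                  in g a , trans (cong (offset (f b)) (fg a)) eq
  ; bottom            = g bottom
  ; top               = g top
  ; start-bottom      = trans (cong start (fg bottom)) start-bottom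
  ; start-≤           = λ b → subst (λ a → start (f b) ≤ start a) (sym (fg top)) (start-≤ (f b))
  }
  where open Staircase S

staircase : ∀ q → Staircase (Fin (suc (pred2^ q))) (pred2^ q)
staircase zero = record
  { start             = λ _ → 0
  ; offset            = λ _ _ → 0
  ; symmetric         = λ _ _ → refl
  ; offset-loop       = λ _ → refl
  ; offset-≤          = λ _ _ → z≤n
  ; offset-injective  = λ { zero {zero} {zero} _ → refl }
  ; offset-surjective = λ { _ z≤n → zero , refl }
  ; bottom            = zero
  ; top               = zero
  ; start-bottom      = refl
  ; start-≤           = λ _ → z≤n
  }
staircase (suc q) =
  relabel (splitAt n) (join n n) (splitAt-join n n) (join-splitAt n n) (double (staircase q))
  where n = suc (pred2^ q)

-- Each doubling raises the largest start by the current `m`; summing 2^i - 1 over i < q gives 2^q -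
-- 1 - q.
start-top : ∀ q → Staircase.start (staircase q) (Staircase.top (staircase q)) + q ≡ pred2^ q
start-top zero    = refl
start-top (suc q) = begin
  start (splitAt n (join n n (inj₂ top))) + suc q
    ≡⟨ cong (λ u → start u + suc q) (splitAt-join n n (inj₂ top)) ⟩
  S.start S.top + pred2^ q + suc q ≡⟨ shuffle (S.start S.top) (pred2^ q) q ⟩
  S.start S.top + q + n           ≡⟨ cong (_+ n) (start-top q) ⟩
  pred2^ q + n                     ∎
  where
  open ≡-Reasoning
  n = suc (pred2^ q)
  module S = Staircase (staircase q)
  open S using (top)
  open Staircase (double (staircase q)) using (start)
  shuffle : ∀ a b c → a + b + suc c ≡ a + c + suc b
  shuffle = solve-∀

-- Degrees, distances and colours in general graphs

suc∣p∖x∣≡∣p∣ : ∀ {n} {p : Subset n} {x} → x ∈ p → suc ∣ p ∖ x ∣ ≡ ∣ p ∣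
suc∣p∖x∣≡∣p∣ {p = _ ∷ p}       here      = cong (λ r → suc ∣ r ∣) (p─⊥≡p p)
suc∣p∖x∣≡∣p∣ {p = outside ∷ p} (there h) = suc∣p∖x∣≡∣p∣ h
suc∣p∖x∣≡∣p∣ {p = inside ∷ p}  (there h) = cong suc (suc∣p∖x∣≡∣p∣ h)

x∉p∖x : ∀ {n} (p : Subset n) {x} → ¬ x ∈ (p ∖ x)
x∉p∖x (_ ∷ p) (there h) = x∉p∖x p h

-- Induction on `k`: the element with the largest value `lo + k` is removed, and by injectivity the
-- others fill the shorter interval.
interval-size : ∀ {n} (f : Fin n → ℕ) lo k (p : Subset n) →
  (∀ {x} → x ∈ p → lo ≤ f x × f x < lo + k) →
  (∀ {x y} → x ∈ p → y ∈ p → f x ≡ f y → x ≡ y) →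
  (∀ {c} → lo ≤ c → c < lo + k → ∃[ x ] x ∈ p × f x ≡ c) →
  ∣ p ∣ ≡ k
interval-size {n} f lo zero p into inj onto =
  trans (cong ∣_∣ (Empty-unique λ (x , x∈p) →
    let lo≤ , <lo = into x∈p in <-irrefl refl (<-≤-trans <lo (subst (_≤ f x) (sym (+-identityʳ lo)) lo≤))))
  (∣⊥∣≡0 n)
interval-size f lo (suc k) p into inj onto
  with x , x∈p , fx ← onto (m≤m+n lo k) (+-monoʳ-< lo (n<1+n k)) =
  trans (sym (suc∣p∖x∣≡∣p∣ x∈p)) (cong suc (interval-size f lo k (p ∖ x)
    (λ {y} y∈ → proj₁ (into (sub y∈)) ,
      ≤∧≢⇒< (s≤s⁻¹ (subst (f y <_) (+-suc lo k) (proj₂ (into (sub y∈)))))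
            λ fy → x∉p∖x p (subst (_∈ (p ∖ x)) (inj (sub y∈) x∈p (trans fy (sym fx))) y∈))
    (λ y∈ z∈ → inj (sub y∈) (sub z∈))
    λ lo≤c c<lo+k →
      let y , y∈p , fy = onto lo≤c (<-trans c<lo+k (+-monoʳ-< lo (n<1+n k)))
      in y , x∈p∧x≢y⇒x∈p-y y∈p (λ { refl → <-irrefl (trans (sym fy) fx) c<lo+k }) , fy))
  where
  sub : ∀ {y} → y ∈ (p ∖ x) → y ∈ p
  sub = p─q⊆p p _

module _ (G : Graph) where
  open Graph G using (_~_; adj; Walk; length; order)

  -- Later `f` is the colour of the edge at `v`, so that degrees are read off from the colouring.
  degree-interval : ∀ v (f : Vertex G → ℕ) lo k →
    (∀ {w} → v ~ w → lo ≤ f w × f w < lo + k) →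
    (∀ {u w} → v ~ u → v ~ w → f u ≡ f w → u ≡ w) →
    (∀ {c} → lo ≤ c → c < lo + k → ∃[ w ] v ~ w × f w ≡ c) →
    degree G v ≡ k
  degree-interval v f lo k into inj onto = interval-size f lo k (tabulate (adj v))
    (into ∘ adjacent) (λ u∈ w∈ → inj (adjacent u∈) (adjacent w∈))
    λ lo≤c c< → let w , e , eq = onto lo≤c c< in w , neighbour e , eq
    where
    adjacent : ∀ {w} → w ∈ tabulate (adj v) → v ~ w
    adjacent {w} w∈ = Equivalence.from T-≡ (trans (sym (lookup∘tabulate (adj v) w)) ([]=⇒lookup w∈))
    neighbour : ∀ {w} → v ~ w → w ∈ tabulate (adj v)
    neighbour {w} e = lookup⇒[]= w _ (trans (lookup∘tabulate (adj v) w) (Equivalence.to T-≡ e))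

  Δ-max : ∀ v {k} → degree G v ≡ k → (∀ w → degree G w ≤ k) → Δ G ≡ k
  Δ-max v refl bound = ≤-antisym
    (max≤v⁺ {xs = degs} z≤n (All.map⁺ (All.tabulate λ {w} _ → bound w)))
    (All.lookup (xs≤max 0 degs) (∈-map⁺ (degree G) (∈-allFin v)))
    where degs = map (degree G) (allFin order)

  -- Local conditions identify `δ` with the distance: descending by `δ-step` builds a walk of length
  -- `δ u v`, and by `δ-lipschitz` no walk is shorter.
  module MetricGraph
    (δ : Vertex G → Vertex G → ℕ)
    (δ-zero : ∀ {u v} → δ u v ≡ 0 → u ≡ v)
    (δ-refl : ∀ v → δ v v ≡ 0)
    (δ-lipschitz : ∀ {u v} w → u ~ v → δ u w ≤ suc (δ v w))
    (δ-step : ∀ {u v k} → δ u v ≡ suc k → ∃[ w ] u ~ w × δ w v ≡ k)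
    where

    geodesic : ∀ {k} u v → δ u v ≡ k → ∃[ p ] length {u} {v} p ≡ k
    geodesic {zero} u v eq with refl ← δ-zero eq = ε , refl
    geodesic {suc k} u v eq =
      let w , e , eq′ = δ-step eq
          p , eq″ = geodesic w v eq′
      in e ◅ p , cong suc eq″

    δ-≤-length : ∀ {u v} (p : Walk u v) → δ u v ≤ length p
    δ-≤-length {u} ε = ≤-reflexive (δ-refl u)
    δ-≤-length {v = v} (e ◅ p) = ≤-trans (δ-lipschitz v e) (s≤s (δ-≤-length p))

    isDistance : ∀ u v → IsDistance G u v (δ u v)
    isDistance u v = geodesic u v refl , δ-≤-length

    connected : Connected G
    connected u v = proj₁ (geodesic u v refl)

    isDiameter : ∀ {d} → (∀ u v → δ u v ≤ d) → ∀ u v → δ u v ≡ d → IsDiameter G d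
    isDiameter bound u v refl =
      (λ u v → δ u v , isDistance u v , bound u v) , u , v , isDistance u v

  module _ (color : Vertex G → Vertex G → ℕ)
           (color-sym : ∀ {u v} → u ~ v → color u v ≡ color v u) where

    Sees : Vertex G → ℕ → Set
    Sees v i = ∃[ w ] v ~ w × color v w ≡ i

    -- A discrete intermediate value argument. Either `j` lies between `i` and the colour of the
    -- first edge, both seen at `u`, or that colour replaces `i` at the next vertex.
    all-between : (∀ v {i j k} → Sees v i → Sees v k → i ≤ j → j ≤ k → Sees v j) →
      ∀ {u v} → Walk u v → ∀ {i j k} → Sees u i → Sees v k → i ≤ j → j ≤ k → ∃[ w ] Sees w j
    all-between interval {u} ε si sk i≤j j≤k = u , interval u si sk i≤j j≤k
    all-between interval {u} (_◅_ {j = u′} e p) {j = j} si sk i≤j j≤k with ≤-total j (color u u′)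
    ... | inj₁ j≤c = u , interval u si (u′ , e , refl) i≤j j≤c
    ... | inj₂ c≤j = all-between interval p (u , Graph.~-sym G e , sym (color-sym e)) sk c≤j j≤k

-- Distances in a path and in a complete graph

suc-gap : ∀ {a b} → a ≡ suc b → ∣ a - b ∣ ≡ 1
suc-gap {b = zero}  refl = refl
suc-gap {b = suc b} refl = suc-gap {b = b} refl

gap-suc : ∀ {a b} → b ≡ suc a → ∣ a - b ∣ ≡ 1
gap-suc {a} {b} eq = trans (∣-∣-comm a b) (suc-gap eq)

unit-gap : ∀ a b → ∣ a - b ∣ ≡ 1 → a ≡ suc b ⊎ b ≡ suc a
unit-gap zero    (suc _) refl = inj₂ refl
unit-gap (suc _) zero    refl = inj₁ refl
unit-gap (suc a) (suc b) eq with unit-gap a b eq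
... | inj₁ p = inj₁ (cong suc p)
... | inj₂ p = inj₂ (cong suc p)

-- The bound by `a ⊔ b` keeps the step inside the finite path.
step-towards : ∀ a b {k} → ∣ a - b ∣ ≡ suc k →
  ∃[ c ] ∣ a - c ∣ ≡ 1 × ∣ c - b ∣ ≡ k × c ≤ a ⊔ b
step-towards zero    (suc b) refl = 1 , refl , refl , s≤s z≤n
step-towards (suc a) zero    refl = a , suc-gap {b = a} refl , ∣-∣-identityʳ a , n≤1+n a
step-towards (suc a) (suc b) eq =
  let c , p , q , c≤ = step-towards a b eq in suc c , p , q , s≤s c≤

discrete : ∀ {n} → Fin n → Fin n → ℕ
discrete x y with x ≟ᶠ y
... | yes _ = 0
... | no  _ = 1

discrete-refl : ∀ {n} (x : Fin n) → discrete x x ≡ 0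
discrete-refl x with x ≟ᶠ x
... | yes _  = refl
... | no x≢x = contradiction refl x≢x

discrete-≤1 : ∀ {n} (x y : Fin n) → discrete x y ≤ 1
discrete-≤1 x y with x ≟ᶠ y
... | yes _ = z≤n
... | no  _ = ≤-refl

-- The product of the path on e + 1 vertices and the complete graph on m + 1 vertices

module Prism {m : ℕ} (e : ℕ) (S : Staircase (Fin (suc m)) m) where
  open Staircase S

  Cell : Set
  Cell = Fin (suc e) × Fin (suc m)

  δ : Cell → Cell → ℕ
  δ (i , x) (j , y) = ∣ toℕ i - toℕ j ∣ + discrete x y

  -- Path edges are split by direction, because an edge downwards has the lowest and an edge upwards
  -- the highest colour at its first end.
  data Near : Cell → Cell → Set where
    across : ∀ {i x y} → x ≢ y → Near (i , x) (i , y)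
    below  : ∀ {i j x} → toℕ i ≡ suc (toℕ j) → Near (i , x) (j , x)
    above  : ∀ {i j x} → toℕ j ≡ suc (toℕ i) → Near (i , x) (j , x)

  Near-sym : ∀ {u v} → Near u v → Near v u
  Near-sym (across x≢y) = across (x≢y ∘ sym)
  Near-sym (below eq)   = above eq
  Near-sym (above eq)   = below eq

  Near-irrefl : ∀ {v} → ¬ Near v v
  Near-irrefl (across x≢x) = x≢x refl
  Near-irrefl (below eq)   = m≢1+m+n _ (trans eq (cong suc (sym (+-identityʳ _))))
  Near-irrefl (above eq)   = m≢1+m+n _ (trans eq (cong suc (sym (+-identityʳ _))))

  near? : ∀ u v → Dec (Near u v)
  near? (i , x) (j , y) with i ≟ᶠ j | x ≟ᶠ y
  ... | yes refl | yes refl = no Near-irrefl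
  ... | yes refl | no x≢y   = yes (across x≢y)
  ... | no i≢j   | no x≢y   = no λ { (across _) → i≢j refl ; (below _) → x≢y refl ; (above _) → x≢y refl }
  ... | no i≢j   | yes refl with ∣ toℕ i - toℕ j ∣ ≟ 1
  ...   | yes eq with unit-gap (toℕ i) (toℕ j) eq
  ...     | inj₁ p = yes (below p)
  ...     | inj₂ p = yes (above p)
  near? (i , x) (j , y) | no i≢j   | yes refl | no gap = no λ
    { (across _) → i≢j refl
    ; (below eq) → gap (suc-gap eq)
    ; (above eq) → gap (gap-suc eq) }

  δ-refl : ∀ v → δ v v ≡ 0
  δ-refl (i , x) = cong₂ _+_ (∣n-n∣≡0 (toℕ i)) (discrete-refl x)

  δ-zero : ∀ {u v} → δ u v ≡ 0 → u ≡ v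
  δ-zero {i , x} {j , y} eq with x ≟ᶠ y
  ... | yes refl = cong (_, x) (toℕ-injective (∣m-n∣≡0⇒m≡n (trans (sym (+-identityʳ _)) eq)))
  ... | no _ with () ← trans (sym eq) (+-comm _ 1)

  δ-lipschitz : ∀ {u v} w → Near u v → δ u w ≤ suc (δ v w)
  δ-lipschitz {i , x} (k , z) (across {y = y} _) =
    ≤-trans (+-monoʳ-≤ ∣ toℕ i - toℕ k ∣ (≤-trans (discrete-≤1 x z) (s≤s z≤n)))
            (≤-reflexive (+-suc ∣ toℕ i - toℕ k ∣ (discrete y z)))
  δ-lipschitz (k , z) (below {i} {j} {x} eq) = +-monoˡ-≤ (discrete x z)
    (≤-trans (∣-∣-triangle (toℕ i) (toℕ j) (toℕ k))
      (≤-reflexive (cong (_+ ∣ toℕ j - toℕ k ∣) (suc-gap eq))))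
  δ-lipschitz (k , z) (above {i} {j} {x} eq) = +-monoˡ-≤ (discrete x z)
    (≤-trans (∣-∣-triangle (toℕ i) (toℕ j) (toℕ k))
      (≤-reflexive (cong (_+ ∣ toℕ j - toℕ k ∣) (gap-suc eq))))

  -- The coordinate in the complete graph is corrected first; after that only a step along the path
  -- is left.
  δ-step : ∀ {u v k} → δ u v ≡ suc k → ∃[ w ] Near u w × δ w v ≡ k
  δ-step {i , x} {j , y} eq with x ≟ᶠ y
  ... | no x≢y = (i , y) , across x≢y ,
    trans (cong (∣ toℕ i - toℕ j ∣ +_) (discrete-refl y))
      (trans (+-identityʳ _) (suc-injective (trans (+-comm 1 _) eq)))
  ... | yes refl with step-towards (toℕ i) (toℕ j) (trans (sym (+-identityʳ _)) eq)
  ...   | c , p , q , c≤ = (fromℕ< c<1+e , x) , near ,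
    trans (cong₂ _+_ (cong (∣_- toℕ j ∣) c≡) (discrete-refl x)) (trans (+-identityʳ _) q)
    where
    c<1+e : c < suc e
    c<1+e = ≤-<-trans c≤ (⊔-lub (toℕ<n i) (toℕ<n j))
    c≡ : toℕ (fromℕ< c<1+e) ≡ c
    c≡ = toℕ-fromℕ< c<1+e
    near : Near (i , x) (fromℕ< c<1+e , x)
    near with unit-gap (toℕ i) c p
    ... | inj₁ i≡ = below (trans i≡ (cong suc (sym c≡)))
    ... | inj₂ c≡′ = above (trans c≡ c≡′)

  δ-≤ : ∀ u v → δ u v ≤ suc e
  δ-≤ (i , x) (j , y) = ≤-trans
    (+-mono-≤ (≤-trans (∣m-n∣≤m⊔n (toℕ i) (toℕ j)) (⊔-lub (toℕ≤pred[n] i) (toℕ≤pred[n] j))) (discrete-≤1 x y))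
    (≤-reflexive (+-comm e 1))

  -- Colours and ranks at a cell

  base : Cell → ℕ
  base (i , x) = start x + toℕ i * suc m

  -- Rank 0, the place of the loop, goes to the edge downwards and is vacant only in layer 0.
  first : Fin (suc e) → ℕ
  first i = 1 ∸ toℕ i

  -- Rank m + 1 goes to the edge upwards; the minimum is 0 exactly in the last layer.
  last : Fin (suc e) → ℕ
  last i = m + (1 ⊓ (e ∸ toℕ i))

  -- The colour of an edge at u, relative to base u; the ranks at a vertex of
  -- layer i fill the interval from first i to last i.
  rank : ∀ {u v} → Near u v → ℕ
  rank (across {x = x} {y} _) = offset x y
  rank (below _)              = 0
  rank (above _)              = suc m

  color : Cell → Cell → ℕ
  color (i , x) (j , y) = start x + offset x y + (toℕ i ⊔ toℕ j) * suc m

  color-sym : ∀ u v → color u v ≡ color v u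
  color-sym (i , x) (j , y) = cong₂ (λ a b → a + b * suc m) (symmetric x y) (⊔-comm (toℕ i) (toℕ j))

  -- `base u` is the colour of the loop in the layer of `u`. A path edge has the loop colour of its
  -- upper end, which is `base u` itself or one block `suc m` higher.
  color-rank : ∀ {u v} (n : Near u v) → color u v ≡ base u + rank n
  color-rank (across {i} {x} {y} _) = trans
    (cong (λ a → start x + offset x y + a * suc m) (⊔-idem (toℕ i)))
    (shuffle (start x) (offset x y) (toℕ i * suc m))
    where
    shuffle : ∀ a b c → a + b + c ≡ a + c + b
    shuffle = solve-∀
  color-rank (below {i} {j} {x} eq) = trans
    (cong₂ (λ a b → start x + a + b * suc m) (offset-loop x)
      (m≥n⇒m⊔n≡m (≤-trans (n≤1+n _) (≤-reflexive (sym eq)))))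
    (shuffle (start x) (toℕ i * suc m))
    where
    shuffle : ∀ a b → a + 0 + b ≡ a + b + 0
    shuffle = solve-∀
  color-rank (above {i} {j} {x} eq) = trans
    (cong₂ (λ a b → start x + a + b * suc m) (offset-loop x)
      (trans (m≤n⇒m⊔n≡n (≤-trans (n≤1+n _) (≤-reflexive (sym eq)))) eq))
    (shuffle (start x) (toℕ i) (suc m))
    where
    shuffle : ∀ a b c → a + 0 + (1 + b) * c ≡ a + b * c + c
    shuffle = solve-∀

  -- Since offset 0 belongs to the loop, edges inside a layer have ranks 1 to m and avoid the ranks
  -- 0 and m + 1 of path edges.
  rank-unique : ∀ {u v w} (n : Near u v) (n′ : Near u w) → rank n ≡ rank n′ → v ≡ w
  rank-unique (across {i} {x} _) (across _) eq = cong (i ,_) (offset-injective x eq)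
  rank-unique (across {x = x} x≢y) (below _) eq =
    contradiction (offset-injective x (trans (offset-loop x) (sym eq))) x≢y
  rank-unique (across {x = x} {y} _) (above _) eq =
    contradiction (offset-≤ x y) (<⇒≱ (≤-reflexive (sym eq)))
  rank-unique (below _) (across {x = x} x≢y) eq =
    contradiction (offset-injective x (trans (offset-loop x) eq)) x≢y
  rank-unique (below {x = x} p) (below q) _ = cong (_, x) (toℕ-injective (suc-injective (trans (sym p) q)))
  rank-unique (above _) (across {x = x} {y} _) eq =
    contradiction (offset-≤ x y) (<⇒≱ (≤-reflexive eq))
  rank-unique (above {x = x} p) (above q) _ = cong (_, x) (toℕ-injective (trans p (sym q)))

  1⊓-pos : ∀ {a b} → suc a ≤ b → 1 ⊓ (b ∸ a) ≡ 1
  1⊓-pos {a} a<b = m≤n⇒m⊓n≡m (m<n⇒0<n∸m a<b)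

  first≤rank : ∀ {u v} (n : Near u v) → first (proj₁ u) ≤ rank n
  first≤rank (across {i} {x} {y} x≢y) = ≤-trans (m∸n≤m 1 (toℕ i))
    (n≢0⇒n>0 λ eq → x≢y (offset-injective x (trans (offset-loop x) (sym eq))))
  first≤rank (below {i} {j} eq) = ≤-reflexive (trans (cong (1 ∸_) eq) (0∸n≡0 (toℕ j)))
  first≤rank (above {i} _) = ≤-trans (m∸n≤m 1 (toℕ i)) (s≤s z≤n)

  rank≤last : ∀ {u v} (n : Near u v) → rank n ≤ last (proj₁ u)
  rank≤last (across {x = x} {y} _) = ≤-trans (offset-≤ x y) (m≤m+n m _)
  rank≤last (below _) = z≤n
  rank≤last (above {i} {j} eq) = ≤-reflexive (trans (+-comm 1 m)
    (cong (m +_) (sym (1⊓-pos (≤-trans (≤-reflexive (sym eq)) (toℕ≤pred[n] j))))))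

  rank-surjective : ∀ u {k} → first (proj₁ u) ≤ k → k ≤ last (proj₁ u) →
                    ∃[ v ] ∃[ n ] rank {u} {v} n ≡ k
  -- In layer 0 rank 0 is excluded by `first`, so a layer below exists.
  rank-surjective (suc i , x) {zero} _ _ =
    (inject₁ i , x) , below (cong suc (sym (toℕ-inject₁ i))) , refl
  rank-surjective (i , x) {suc k} _ k≤ with suc k ≤? m
  ... | yes k≤m = let y , eq = offset-surjective x k≤m in
    (i , y) ,
    across (λ x≡y → contradiction (trans (sym (offset-loop x)) (trans (cong (offset x) x≡y) eq)) λ ()) ,
    eq
  ... | no k≰m = (fromℕ< i<e , x) , above (toℕ-fromℕ< i<e) , ≤-antisym (≰⇒> k≰m)
         (≤-trans k≤ (≤-trans (+-monoʳ-≤ m (m⊓n≤m 1 _)) (≤-reflexive (+-comm m 1))))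
    where
    i<e : suc (toℕ i) < suc e
    -- In the last layer `last` is only `m`, too small for this rank.
    i<e = s≤s (≰⇒> λ e≤i → k≰m (≤-trans k≤ (≤-reflexive
      (trans (cong (λ a → m + (1 ⊓ a)) (m≤n⇒m∸n≡0 e≤i)) (+-identityʳ m)))))

  -- The prism as a graph on numbered vertices

  cell : Fin (suc e * suc m) → Cell
  cell = remQuot (suc m)

  vertex : Cell → Fin (suc e * suc m)
  vertex = uncurry combine

  cell-vertex : ∀ u → cell (vertex u) ≡ u
  cell-vertex (i , x) = remQuot-combine i x

  cell-injective : ∀ {u v} → cell u ≡ cell v → u ≡ v
  cell-injective {u} {v} eq = trans (sym (combine-remQuot (suc m) u))
    (trans (cong vertex eq) (combine-remQuot (suc m) v))

  prism : Graph
  prism = record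
    { order    = suc e * suc m
    ; adj      = λ u v → ⌊ near? (cell u) (cell v) ⌋
    ; ~-sym    = λ e → fromWitness (Near-sym (toWitness e))
    ; ~-irrefl = λ e → Near-irrefl (toWitness e)
    }

  open Graph prism using (_~_)

  near : ∀ u v → u ~ v → Near (cell u) (cell v)
  near _ _ = toWitness

  edge : ∀ u v → Near (cell u) v → u ~ vertex v
  edge u v n = fromWitness (subst (Near (cell u)) (sym (cell-vertex v)) n)

  δᵛ : Vertex prism → Vertex prism → ℕ
  δᵛ u v = δ (cell u) (cell v)

  δᵛ-zero : ∀ {u v} → δᵛ u v ≡ 0 → u ≡ v
  δᵛ-zero {u} {v} eq = cell-injective (δ-zero {cell u} {cell v} eq)

  δᵛ-lipschitz : ∀ {u v} w → u ~ v → δᵛ u w ≤ suc (δᵛ v w)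
  δᵛ-lipschitz {u} {v} w e = δ-lipschitz (cell w) (near u v e)

  δᵛ-step : ∀ {u v k} → δᵛ u v ≡ suc k → ∃[ w ] u ~ w × δᵛ w v ≡ k
  δᵛ-step {u} {v} eq =
    let w , n , eq′ = δ-step {cell u} {cell v} eq
    in vertex w , edge u w n , trans (cong (λ w → δ w (cell v)) (cell-vertex w)) eq′

  open MetricGraph prism δᵛ
    (λ {u} {v} → δᵛ-zero {u} {v})
    (δ-refl ∘ cell)
    (λ {u} {v} → δᵛ-lipschitz {u} {v})
    (λ {u} {v} → δᵛ-step {u} {v})
    public using (connected; isDiameter)

  -- Attained between the two end layers in different columns; `1 ≤ m` provides the second column.
  diameter : 1 ≤ m → IsDiameter prism (suc e)
  diameter (s≤s _) = isDiameter (λ u v → δ-≤ (cell u) (cell v)) (vertex (zero , zero))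
    (vertex (fromℕ e , suc zero))
    (trans (cong₂ δ (cell-vertex (zero , zero)) (cell-vertex (fromℕ e , suc zero)))
      (trans (cong (_+ 1) (toℕ-fromℕ e)) (+-comm e 1)))

  colorᵛ : Vertex prism → Vertex prism → ℕ
  colorᵛ u v = color (cell u) (cell v)

  Spectrum : Cell → ℕ → Set
  Spectrum u c = base u + first (proj₁ u) ≤ c × c ≤ base u + last (proj₁ u)

  color-spectrum : ∀ {u v} → Near u v → Spectrum u (color u v)
  color-spectrum {u} {v} n =
    subst (Spectrum u) (sym (color-rank n))
      (+-monoʳ-≤ (base u) (first≤rank n) , +-monoʳ-≤ (base u) (rank≤last n))

  Sees′ : Vertex prism → ℕ → Set
  Sees′ v i = ∃[ w ] v ~ w × colorᵛ v w ≡ i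

  spectrum-color : ∀ v {c} → Spectrum (cell v) c → Sees′ v c
  spectrum-color v {c} (lo , hi)
    with k , refl ← m≤n⇒∃[o]m+o≡n (≤-trans (m≤m+n (base (cell v)) _) lo) =
    let w , n , eq = rank-surjective (cell v) (+-cancelˡ-≤ (base (cell v)) _ _ lo)
                                          (+-cancelˡ-≤ (base (cell v)) _ _ hi)
    in vertex w , edge v w n ,
       trans (cong (color (cell v)) (cell-vertex w)) (trans (color-rank n) (cong (base (cell v) +_) eq))

  sees-spectrum : ∀ v {c} → Sees′ v c → Spectrum (cell v) c
  sees-spectrum v (w , e , refl) = color-spectrum (near v w e)

  color-injective : ∀ v u w → v ~ u → v ~ w → colorᵛ v u ≡ colorᵛ v w → u ≡ w
  color-injective v u w e e′ eq = cell-injective (rank-unique (near v u e) (near v w e′)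
    (+-cancelˡ-≡ (base (cell v)) _ _
      (trans (sym (color-rank (near v u e))) (trans eq (color-rank (near v w e′))))))

  -- Degrees in the prism

  width : Fin (suc e) → ℕ
  width i = m + (1 ⊓ toℕ i + 1 ⊓ (e ∸ toℕ i))

  first+width : ∀ i → first i + width i ≡ suc (last i)
  first+width zero = refl
  first+width (suc i) = trans (cong (_+ width (suc i)) (0∸n≡0 (toℕ i))) (+-suc m _)

  -- The colours at `v` are distinct and fill its spectrum, whose length is `m` plus one for each
  -- adjacent layer.
  degree≡width : ∀ v → degree prism v ≡ width (proj₁ (cell v))
  degree≡width v = degree-interval prism v (colorᵛ v) (base (cell v) + first i) (width i)
    (λ {w} e → let lo , hi = color-spectrum (near v w e) in lo , ≤-<-trans hi (≤-reflexive (sym end)))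
    (λ {u} {w} → color-injective v u w)
    λ lo c< → let w , e , eq = spectrum-color v (lo , s≤s⁻¹ (≤-trans c< (≤-reflexive end))) in w , e , eq
    where
    i = proj₁ (cell v)
    end : base (cell v) + first i + width i ≡ suc (base (cell v) + last i)
    end = trans (+-assoc (base (cell v)) _ _) (trans (cong (base (cell v) +_) (first+width i)) (+-suc _ _))

  Δ-prism : ∀ i {k} → width i ≡ k → (∀ j → width j ≤ k) → Δ prism ≡ k
  Δ-prism i eq bound = Δ-max prism (vertex (i , zero))
    (trans (degree≡width (vertex (i , zero))) (trans (cong (width ∘ proj₁) (cell-vertex (i , zero))) eq))
    λ w → ≤-trans (≤-reflexive (degree≡width w)) (bound (proj₁ (cell w)))

  -- The interval colouring of the prism

  span : ℕ
  span = start top + (m + e * suc m)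

  -- `span` is the upper end of the spectrum of `top` in the last layer. In a lower layer the extra
  -- colour of the upward edge is outweighed by the blocks of the layers above.
  spectrum-≤ : ∀ u {c} → Spectrum u c → c ≤ span
  spectrum-≤ (i , x) (_ , hi) = ≤-trans hi (≤-trans (≤-reflexive (+-assoc (start x) _ _))
    (+-mono-≤ (start-≤ x) (rows (toℕ i) (toℕ≤pred[n] i))))
    where
    rows : ∀ a → a ≤ e → a * suc m + (m + (1 ⊓ (e ∸ a))) ≤ m + e * suc m
    rows a a≤e with k , refl ← m≤n⇒∃[o]m+o≡n a≤e = begin
      a * suc m + (m + (1 ⊓ (a + k ∸ a)))  ≡⟨ cong (λ b → a * suc m + (m + (1 ⊓ b))) (m+n∸m≡n a k) ⟩
      a * suc m + (m + (1 ⊓ k))            ≤⟨ +-monoʳ-≤ (a * suc m) (+-monoʳ-≤ m 1⊓k≤) ⟩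
      a * suc m + (m + k * suc m)          ≡⟨ shuffle a k m ⟩
      m + (a + k) * suc m                  ∎
      where
      open ≤-Reasoning
      1⊓k≤ : 1 ⊓ k ≤ k * suc m
      1⊓k≤ = ≤-trans (m⊓n≤n 1 k) (m≤m*n k (suc m))
      shuffle : ∀ a k m → a * suc m + (m + k * suc m) ≡ m + (a + k) * suc m
      shuffle = solve-∀

  spectrum-≥ : ∀ u {c} → Spectrum u c → 1 ≤ c
  spectrum-≥ (zero , x) (lo , _) = ≤-trans (m≤n+m 1 (base (zero , x))) lo
  spectrum-≥ (suc i , x) (lo , _) = ≤-trans (≤-trans (s≤s z≤n) (m≤n+m _ (start x)))
    (≤-trans (m≤m+n (base (suc i , x)) _) lo)

  -- Colour 1 is seen at `source` and `span` at `target`; connectedness and `all-between` supply all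
  -- colours in between.
  prism-coloring : 1 ≤ m → IntervalColoring prism span
  prism-coloring 1≤m = record
    { color       = λ u v _ → colorᵛ u v
    ; color-sym   = λ {u} {v} _ _ → color-sym (cell u) (cell v)
    ; t-positive  = spectrum-≥ (fromℕ e , top) top-spectrum
    ; color-range = λ {u} {v} e → let s = color-spectrum (near u v e) in
                      spectrum-≥ (cell u) s , spectrum-≤ (cell u) s
    ; all-used    = λ i → all-between prism colorᵛ (λ {u} {v} _ → color-sym (cell u) (cell v)) convex
                      (connected source target) source-sees target-sees
    ; proper      = λ {v} {u} {w} e e′ u≢w eq → u≢w (color-injective v u w e e′ eq)
    ; interval    = convex
    }
    where
    convex : ∀ v {i j k} → Sees′ v i → Sees′ v k → i ≤ j → j ≤ k → Sees′ v j
    convex v si sk i≤j j≤k = spectrum-color v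
      (≤-trans (proj₁ (sees-spectrum v si)) i≤j , ≤-trans j≤k (proj₂ (sees-spectrum v sk)))
    bottom-spectrum : Spectrum (zero , bottom) 1
    -- With a single layer `last` is `m`, so rank 1 needs `1 ≤ m`.
    bottom-spectrum rewrite start-bottom = ≤-refl , ≤-trans 1≤m (m≤m+n m _)
    top-spectrum : Spectrum (fromℕ e , top) span
    top-spectrum =
      ≤-trans (≤-reflexive (+-assoc (start top) _ _)) (+-monoʳ-≤ (start top)
        (≤-trans (+-monoʳ-≤ _ (≤-trans (m∸n≤m 1 (toℕ (fromℕ e))) 1≤m)) (≤-reflexive rows))) ,
      ≤-trans (≤-reflexive (cong (start top +_) (sym rows)))
        (≤-trans (+-monoʳ-≤ (start top) (+-monoʳ-≤ (toℕ (fromℕ e) * suc m) (m≤m+n m _)))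
          (≤-reflexive (sym (+-assoc (start top) _ _))))
      where
      rows : toℕ (fromℕ e) * suc m + m ≡ m + e * suc m
      rows = trans (cong (λ a → a * suc m + m) (toℕ-fromℕ e)) (+-comm (e * suc m) m)
    source target : Vertex prism
    source = vertex (zero , bottom)
    target = vertex (fromℕ e , top)
    source-sees : Sees′ source 1
    source-sees = spectrum-color source
      (subst (λ u → Spectrum u 1) (sym (cell-vertex (zero , bottom))) bottom-spectrum)
    target-sees : Sees′ target span
    target-sees = spectrum-color target
      (subst (λ u → Spectrum u span) (sym (cell-vertex (fromℕ e , top))) top-spectrum)

-- The maximum degree and the bound on W

open import Data.Integer.Base using (ℤ; +_)

module _ (q : ℕ) where

  estimate : ℕ → ℕ → ℤ
  estimate d D = byDiameter d
    ((+ d ℤ.+ + 1) ℤ.* (+ D ℤ.- + 1) ℤ.- + q ℤ.+ + 2)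
    ((+ d ℤ.+ + 1) ℤ.* (+ D ℤ.- + 1) ℤ.- + q ℤ.+ + 1)
    ((+ d ℤ.+ + 1) ℤ.* (+ D ℤ.- + 1) ℤ.- + q ℤ.- + 2)

  maxDegree : ℕ → ℕ
  maxDegree e = byDiameter (suc e) (2 ^ q ∸ 1) (2 ^ q) (2 ^ q + 1)

  Δ-prism≡maxDegree : ∀ e → Δ (Prism.prism e (staircase q)) ≡ maxDegree e
  Δ-prism≡maxDegree 0 = Prism.Δ-prism 0 (staircase q) zero eq λ { zero → ≤-reflexive eq }
    where
    eq : pred2^ q + 0 ≡ 2 ^ q ∸ 1
    eq = trans (+-identityʳ _) (cong (_∸ 1) (suc-pred2^ q))
  Δ-prism≡maxDegree 1 = Prism.Δ-prism 1 (staircase q) zero eq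
    λ { zero → ≤-reflexive eq ; (suc zero) → ≤-reflexive eq }
    where
    eq : pred2^ q + 1 ≡ 2 ^ q
    eq = trans (+-comm (pred2^ q) 1) (suc-pred2^ q)
  -- With three or more layers, layer 1 is inner and has layers on both sides.
  Δ-prism≡maxDegree (suc (suc e)) = Prism.Δ-prism (2 + e) (staircase q) (suc zero) eq λ i →
    ≤-trans (+-monoʳ-≤ (pred2^ q) (+-mono-≤ (m⊓n≤m 1 (toℕ i)) (m⊓n≤m 1 _))) (≤-reflexive eq)
    where
    eq : pred2^ q + 2 ≡ 2 ^ q + 1
    eq = trans (+-suc (pred2^ q) 1) (cong (_+ 1) (suc-pred2^ q))

  -- The required bound is exactly the number of colours used. Writing 2^q - 1 as `r + q` by
  -- `start-top` removes the power, and a polynomial identity remains in each case.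
  estimate≡span : ∀ e → estimate (suc e) (maxDegree e) ≡ + Prism.span e (staircase q)
  estimate≡span e = trans (cong (estimate (suc e)) (sym (degree-value e)))
    (trans (value e) (cong (λ b → + (r + (b + e * suc b))) (start-top q)))
    where
    open +-*-Solver
    open Staircase (staircase q) using (start; top)
    r = start top

    degree-value : ∀ e → byDiameter (suc e) (r + q) (1 + (r + q)) (2 + (r + q)) ≡ maxDegree e
    degree-value 0 = trans (start-top q) (cong (_∸ 1) (suc-pred2^ q))
    degree-value 1 = trans (cong suc (start-top q)) (suc-pred2^ q)
    degree-value (suc (suc e)) = trans (cong (λ b → suc (suc b)) (start-top q))
      (trans (cong suc (suc-pred2^ q)) (+-comm 1 (2 ^ q)))

    value : ∀ e → estimate (suc e) (byDiameter (suc e) (r + q) (1 + (r + q)) (2 + (r + q))) ≡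
                  + (r + (r + q + e * suc (r + q)))
    value 0 = solve 2 (λ r q →
      (con (+ 1) :+ con (+ 1)) :* ((r :+ q) :- con (+ 1)) :- q :+ con (+ 2) :=
      r :+ ((r :+ q) :+ con (+ 0))) refl (+ r) (+ q)
    value 1 = solve 2 (λ r q →
      (con (+ 2) :+ con (+ 1)) :* ((con (+ 1) :+ (r :+ q)) :- con (+ 1)) :- q :+ con (+ 1) :=
      r :+ ((r :+ q) :+ ((con (+ 1) :+ (r :+ q)) :+ con (+ 0)))) refl (+ r) (+ q)
    value (suc (suc e)) = trans
      (solve 3 (λ r q e →
        ((con (+ 3) :+ e) :+ con (+ 1)) :* ((con (+ 2) :+ (r :+ q)) :- con (+ 1)) :- q :- con (+ 2) :=
        r :+ ((r :+ q) :+ (con (+ 2) :+ e) :* (con (+ 1) :+ (r :+ q)))) refl (+ r) (+ q) (+ e))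
      -- The solver ends in a product of integers, here turned into the image of a product of
      -- naturals.
      (cong (λ s → + r ℤ.+ ((+ r ℤ.+ + q) ℤ.+ s)) (sym (ℤ.pos-* (2 + e) (suc (r + q)))))

theorem5 : (d q : ℕ) → 1 ≤ d → 1 ≤ q →
    ∃[ G ] Connected G
    × IsDiameter G d
    × Δ G ≡ byDiameter d (2 ^ q ∸ 1) (2 ^ q) (2 ^ q + 1)
    × 𝔑 G
    × (∃[ w ] IsW G w
    × byDiameter d
    ((+ d ℤ.+ + 1) ℤ.* (+ Δ G ℤ.- + 1) ℤ.- + q ℤ.+ + 2)
    ((+ d ℤ.+ + 1) ℤ.* (+ Δ G ℤ.- + 1) ℤ.- + q ℤ.+ + 1)
    ((+ d ℤ.+ + 1) ℤ.* (+ Δ G ℤ.- + 1) ℤ.- + q ℤ.- + 2)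
    ℤ.≤ + w)
theorem5 (suc e) q _ 1≤q =
  let w , isW , span≤w = ∃W prism C
  in prism , connected , diameter 1≤m , Δ-prism≡maxDegree q e , (span , C) , w , isW ,
     ℤ.≤-trans (ℤ.≤-reflexive (trans (cong (estimate q (suc e)) (Δ-prism≡maxDegree q e))
                                     (estimate≡span q e)))
               (ℤ.+≤+ span≤w)
  where
  open Prism e (staircase q)
  -- As q is positive, the complete graph has at least two vertices.
  1≤m : 1 ≤ pred2^ q
  1≤m = s≤s⁻¹ (≤-trans (^-monoʳ-≤ 2 1≤q) (≤-reflexive (sym (suc-pred2^ q))))
  C : IntervalColoring prism span
  C = prism-coloring 1≤m
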